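{- Call a triple of integers $(q,b,m)$ with $1\le b\le q$ and $m\ge 2$ a solution if $$\sum_{\substack{1\le i\le m-1\\ i\equiv b \bmod q}} i^2 = m^2 .$$ Then: (1) For every solution $(q,b,m)$, the number of terms in the sum on the left-hand side is two or four. (2) There are infinitely many solutions for which the sum has exactly two terms, and infinitely many solutions for which the sum has exactly four terms. (3) Every solution $(q,b,m)$ is "good", that is, it satisfies $$\left\lfloor \frac{m-b}{q}\right\rfloor=\left\lfloor\frac{m-b-1}{q}\right\rfloor .$$ (4) Each solution $(q,b,m)$ belongs to an infinite set of evenly spaced integer points along a line in $\mathbb{R}^3$ consisting of solutions, namely for every integer $j\ge 1$ the triple $(jq,jb,jm)$ is also a solution.
   Context: The number of terms in the sum is the number of integers $i$ with $1\le i\le m-1$ and $i\equiv b \pmod q$. -}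

module Defs where

open import Data.Integer using (+_; _-_; 1ℤ)
open import Data.List using (List; filter; length; map; upTo)
open import Data.Nat using (ℕ; _+_; _*_; _^_; _≤_; _≤?_; ∣_-_∣; NonZero; >-nonZero)
open import Data.Nat.Divisibility using (_∣_; _∣?_)
open import Data.Nat.ListAction using (sum)
open import Data.Nat.Properties using (≤-trans)
open import Data.Product using (_×_; _,_; ∃-syntax)
open import Data.Rational.Unnormalised using (_/_; floor)
open import Function using (_⇔_)
open import Function.Definitions using (Injective)
open import Level using (0ℓ)
open import Relation.Binary.PropositionalEquality using (_≡_; _≢_)
open import Relation.Nullary using (Dec)
open import Relation.Nullary.Decidable using (_×-dec_)
open import Relation.Unary using (Pred)

-- (q , b , m).  The constraints 1 ≤ b ≤ q and 2 ≤ m make every entry of a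
-- solution positive, so natural-number entries lose nothing.
Triple : Set
Triple = ℕ × ℕ × ℕ

infix 4 _≡_mod_ _≡?_mod_

_≡_mod_ : ℕ → ℕ → ℕ → Set
i ≡ b mod q = q ∣ ∣ i - b ∣

_≡?_mod_ : ∀ i b q → Dec (i ≡ b mod q)
i ≡? b mod q = q ∣? ∣ i - b ∣

-- upTo m lists 0 , … , m - 1.
indices : Triple → List ℕ
indices (q , b , m) = filter (λ i → (1 ≤? i) ×-dec (i ≡? b mod q)) (upTo m)

numTerms : Triple → ℕ
numTerms t = length (indices t)

sumOfSquares : Triple → ℕ
sumOfSquares t = sum (map (_^ 2) (indices t))

IsSolution : Pred Triple 0ℓ
IsSolution t@(q , b , m) =
  1 ≤ b × b ≤ q × 2 ≤ m × sumOfSquares t ≡ m ^ 2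

-- Subtraction is in ℤ and the quotients are rational numbers, so nothing is
-- truncated before the floor is taken.
Good : (t : Triple) → let (q , _ , _) = t in .{{NonZero q}} → Set
Good (q , b , m) =
  floor ((+ m - + b) / q) ≡ floor ((+ m - + b - 1ℤ) / q)

solution⇒q≢0 : ∀ t → IsSolution t → let (q , _ , _) = t in NonZero q
solution⇒q≢0 _ (1≤b , b≤q , _) = >-nonZero (≤-trans 1≤b b≤q)

Infinite : Pred Triple 0ℓ → Set
Infinite P = ∃[ f ] Injective {A = ℕ} _≡_ _≡_ f × (∀ n → P (f n))

infixl 6 _⊕_
infixl 7 _⊙_

_⊕_ : Triple → Triple → Triple
(x , y , z) ⊕ (x′ , y′ , z′) = x + x′ , y + y′ , z + z′

_⊙_ : ℕ → Triple → Triple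
k ⊙ (x , y , z) = k * x , k * y , k * z

-- P is exactly the set of points a , a + d , a + 2d , … of some line with
-- direction d ≠ 0.
EvenlySpacedOnLine : Pred Triple 0ℓ → Set
EvenlySpacedOnLine P =
  ∃[ a ] ∃[ d ] d ≢ (0 , 0 , 0) × (∀ t → P t ⇔ (∃[ k ] t ≡ a ⊕ k ⊙ d))

PositiveMultiples : Triple → Pred Triple 0ℓ
PositiveMultiples t s = ∃[ j ] 1 ≤ j × s ≡ j ⊙ t

{-# OPTIONS --safe #-}
module Submission where

-- If the sum has n terms, then b + (n-1)q < m ≤ b + nq.  For n ≥ 5 the sum
-- exceeds (b + nq)², and for n ≤ 1 it differs from m² trivially.  For n = 3 it
-- is 3b² + 6bq + 5q², which is a square only if 3 divides m, q and b, so
-- infinite descent forces q = 0.  Failure of goodness means m = b + nq: for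
-- n = 2 this contradicts b ≤ q, and for n = 4 it says 3b² + 4bq = 2q², which
-- 2-adic descent excludes.  The number of terms and the equation are preserved
-- by scaling, so one solution of each kind gives infinitely many.

open import Defs
open import Data.Integer as ℤ using (+_; 1ℤ)
import Data.Integer.Properties as ℤ
open import Data.List using (List; []; _∷_; [_]; _++_; applyUpTo; filter; length; map; upTo)
open import Data.List.Properties
  using (++-identityʳ; applyUpTo-∷ʳ; filter-++; filter-accept; filter-reject; length-map;
         map-applyUpTo; map-cong; map-upTo; upTo-∷ʳ)
open import Data.Nat
  using (ℕ; zero; suc; _+_; _*_; _∸_; _^_; _%_; _/_; _≤_; _<_; z≤n; s≤s; z<s; _≤?_;
         NonZero; >-nonZero; >-nonZero⁻¹; ≢-nonZero; ≢-nonZero⁻¹)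
open import Data.Nat.Divisibility
  using (_∣_; divides; divides-refl; ∣m+n∣m⇒∣n; >⇒∤; n∣m⇒m%n≡0; m%n≡0⇒n∣m; m∣m*n; n∣m*n)
open import Data.Nat.DivMod
  using (%-distribˡ-+; %-distribˡ-*; m%n<n; +-distrib-/-∣ˡ; m*n/n≡m; m<n⇒m/n≡0)
open import Data.Nat.Induction using (Acc; acc; <-wellFounded)
open import Data.Nat.ListAction using (sum)
open import Data.Nat.ListAction.Properties using (sum-++)
open import Data.Nat.Primality using (Prime; prime?; euclidsLemma)
open import Data.Nat.Properties
open import Data.Nat.Tactic.RingSolver using (solve-∀)
open import Data.Product using (_×_; _,_; ∃-syntax; proj₁; proj₂)
open import Data.Rational.Unnormalised as ℚᵘ using (floor)
open import Data.Sum using (_⊎_; inj₁; inj₂; reduce)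
open import Function using (mk⇔)
open import Relation.Binary.Definitions using (tri<; tri≈; tri>)
open import Relation.Binary.PropositionalEquality
  using (_≡_; _≢_; refl; sym; trans; cong; cong₂; subst; module ≡-Reasoning)
open import Relation.Nullary using (¬_; yes; no; contradiction)
open import Relation.Nullary.Decidable using (_×-dec_; toWitness)
open import Relation.Unary using (_∈_; _⊆_; Decidable)

open import Algebra.Properties.CommutativeSemiring.Exp +-*-commutativeSemiring
  using (^-distrib-*)

-- The index list as an initial segment of an arithmetic progression.

progression : ℕ → ℕ → ℕ → List ℕ
progression q b n = applyUpTo (λ i → b + i * q) n

-- This pins `n` down as the number of terms `b + i * q` below `m`. Bounding every `i < n`, rather
-- than only the last term, lets `n = 0` fit without a predecessor.
FirstPast : Triple → ℕ → Set
FirstPast (q , b , m) n = (∀ i → i < n → b + i * q < m) × m ≤ b + n * q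

FirstPast-unique : ∀ t {n n′} → FirstPast t n → FirstPast t n′ → n ≡ n′
FirstPast-unique t {n} {n′} (below , above) (below′ , above′) with <-cmp n n′
... | tri< n<n′ _ _ = contradiction (below′ n n<n′) (≤⇒≯ above)
... | tri≈ _ n≡n′ _ = n≡n′
... | tri> _ _ n′<n = contradiction (below n′ n′<n) (≤⇒≯ above′)

progression-⊙ : ∀ j q b i → j * (b + i * q) ≡ j * b + i * (j * q)
progression-⊙ = solve-∀

FirstPast-⊙ : ∀ j t {n} → 1 ≤ j → FirstPast t n → FirstPast (j ⊙ t) n
FirstPast-⊙ j (q , b , m) {n} 1≤j (below , above) =
  (λ i i<n → subst (_< j * m) (progression-⊙ j q b i) (*-monoʳ-< j (below i i<n))) ,
  subst (j * m ≤_) (progression-⊙ j q b n) (*-monoʳ-≤ j above)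
  where instance _ = >-nonZero 1≤j

∣between-multiples : ∀ {q x} k → k * q < x → x < suc k * q → ¬ q ∣ x
∣between-multiples {q} {x} k kq<x x<q+kq (divides-refl l) =
  contradiction (*-cancelʳ-< q l (suc k) x<q+kq) (≤⇒≯ (*-cancelʳ-< q k l kq<x))

-- For `n = 0`, the bounds `1 ≤ m < b ≤ q` put b - m strictly between 0 and `q`. For `n = suc k`,
-- the difference m - b lies strictly between the consecutive multiples `k * q` and `suc k * q`.
≢mod-between : ∀ {q b m} n → b ≤ q → 1 ≤ m → FirstPast (q , b , m) n → m < b + n * q →
               ¬ m ≡ b mod q
≢mod-between {q} {b} {m} zero b≤q 1≤m _ m<b+0 q∣ =
  >⇒∤ {{>-nonZero (subst (0 <_) (sym (m≤n⇒∣m-n∣≡n∸m (<⇒≤ m<b))) (m<n⇒0<n∸m m<b))}}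
      (subst (_< q) (sym (m≤n⇒∣m-n∣≡n∸m (<⇒≤ m<b))) (<-≤-trans (∸-monoʳ-< 1≤m (<⇒≤ m<b)) b≤q)) q∣
  where
  m<b : m < b
  m<b = subst (m <_) (+-identityʳ b) m<b+0
≢mod-between {q} {b} {m} (suc k) b≤q 1≤m (below , _) m<b+nq q∣ =
  ∣between-multiples k
    (+-cancelˡ-< b _ _ (subst (b + k * q <_) (sym b+d) (below k ≤-refl)))
    (+-cancelˡ-< b _ _ (subst (_< b + suc k * q) (sym b+d) m<b+nq))
    (subst (q ∣_) (m≤n⇒∣n-m∣≡n∸m b≤m) q∣)
  where
  b≤m : b ≤ m
  b≤m = ≤-trans (m≤m+n b (k * q)) (<⇒≤ (below k ≤-refl))
  b+d : b + (m ∸ b) ≡ m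
  b+d = m+[n∸m]≡n b≤m

-- Induction on `m`. Raising the bound to `suc m` tests the single new candidate `m`: it is appended
-- if it equals the next term `b + n * q`, and rejected if it is smaller.
indices-progression : ∀ q b → 1 ≤ b → b ≤ q → ∀ m →
  ∃[ n ] FirstPast (q , b , m) n × indices (q , b , m) ≡ progression q b n
indices-progression q b 1≤b b≤q zero = 0 , ((λ _ ()) , z≤n) , refl
indices-progression q b 1≤b b≤q (suc m) with indices-progression q b 1≤b b≤q m
... | n , past@(below , above) , eq = go (m≤n⇒m<n∨m≡n above)
  where
  P? : Decidable (λ i → 1 ≤ i × i ≡ b mod q)
  P? i = (1 ≤? i) ×-dec (i ≡? b mod q)

  indices-suc : indices (q , b , suc m) ≡ progression q b n ++ filter P? [ m ]
  indices-suc = begin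
    filter P? (upTo (suc m))               ≡⟨ cong (filter P?) (upTo-∷ʳ m) ⟨
    filter P? (upTo m ++ [ m ])            ≡⟨ filter-++ P? (upTo m) [ m ] ⟩
    filter P? (upTo m) ++ filter P? [ m ]  ≡⟨ cong (_++ filter P? [ m ]) eq ⟩
    progression q b n ++ filter P? [ m ]   ∎
    where open ≡-Reasoning

  go : m < b + n * q ⊎ m ≡ b + n * q →
       ∃[ n′ ] FirstPast (q , b , suc m) n′ × indices (q , b , suc m) ≡ progression q b n′
  go (inj₁ m<) = n , ((λ i i<n → m≤n⇒m≤1+n (below i i<n)) , m<) ,
    trans indices-suc (trans (cong (progression q b n ++_) (filter-reject P? m-rejected)) (++-identityʳ _))
    where
    m-rejected : ¬ (1 ≤ m × m ≡ b mod q)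
    m-rejected (1≤m , m≡b) = ≢mod-between n b≤q 1≤m past m< m≡b
  go (inj₂ refl) = suc n , (below′ , +-monoʳ-< b (m<n+m (n * q) (≤-trans 1≤b b≤q))) ,
    trans indices-suc (trans (cong (progression q b n ++_) (filter-accept P? m-accepted))
      (applyUpTo-∷ʳ (λ i → b + i * q) n))
    where
    below′ : ∀ i → i < suc n → b + i * q < suc (b + n * q)
    below′ i (s≤s i≤n) = s≤s (+-monoʳ-≤ b (*-monoˡ-≤ q i≤n))
    m-accepted : 1 ≤ b + n * q × b + n * q ≡ b mod q
    m-accepted = ≤-trans 1≤b (m≤m+n b _) ,
      divides n (trans (m≤n⇒∣n-m∣≡n∸m (m≤m+n b _)) (m+n∸m≡n b _))

-- Scaling of solutions.

-- Both lists are progressions. `FirstPast` survives scaling, so by its uniqueness they have the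
-- same length, and they then agree term by term.
indices-⊙ : ∀ j (t : Triple) → let (q , b , m) = t in 1 ≤ j → 1 ≤ b → b ≤ q →
            indices (j ⊙ t) ≡ map (j *_) (indices t)
indices-⊙ j t@(q , b , m) 1≤j 1≤b b≤q
  with n , past , eq ← indices-progression q b 1≤b b≤q m
  with n′ , past′ , eq′ ← indices-progression (j * q) (j * b) (*-mono-≤ 1≤j 1≤b) (*-monoʳ-≤ j b≤q) (j * m)
  with refl ← FirstPast-unique (j ⊙ t) past′ (FirstPast-⊙ j t 1≤j past)
  = begin
    indices (j ⊙ t)                           ≡⟨ eq′ ⟩
    progression (j * q) (j * b) n             ≡⟨ map-upTo (λ i → j * b + i * (j * q)) n ⟨
    map (λ i → j * b + i * (j * q)) (upTo n)  ≡⟨ map-cong (progression-⊙ j q b) (upTo n) ⟨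
    map (λ i → j * (b + i * q)) (upTo n)      ≡⟨ map-upTo (λ i → j * (b + i * q)) n ⟩
    applyUpTo (λ i → j * (b + i * q)) n       ≡⟨ map-applyUpTo (λ i → b + i * q) (j *_) n ⟨
    map (j *_) (progression q b n)            ≡⟨ cong (map (j *_)) eq ⟨
    map (j *_) (indices t)                    ∎
  where open ≡-Reasoning

sumOfSquares-map-* : ∀ j xs → sum (map (_^ 2) (map (j *_) xs)) ≡ j ^ 2 * sum (map (_^ 2) xs)
sumOfSquares-map-* j []       = sym (*-zeroʳ (j ^ 2))
sumOfSquares-map-* j (x ∷ xs) = begin
  (j * x) ^ 2 + sum (map (_^ 2) (map (j *_) xs)) ≡⟨ cong₂ _+_ (^-distrib-* j x 2) (sumOfSquares-map-* j xs) ⟩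
  j ^ 2 * x ^ 2 + j ^ 2 * sum (map (_^ 2) xs)    ≡⟨ *-distribˡ-+ (j ^ 2) (x ^ 2) _ ⟨
  j ^ 2 * (x ^ 2 + sum (map (_^ 2) xs))          ∎
  where open ≡-Reasoning

IsSolution-⊙ : ∀ j t → 1 ≤ j → IsSolution t → IsSolution (j ⊙ t)
IsSolution-⊙ j t@(q , b , m) 1≤j (1≤b , b≤q , 2≤m , eq) =
  *-mono-≤ 1≤j 1≤b , *-monoʳ-≤ j b≤q , *-mono-≤ 1≤j 2≤m , (begin
    sumOfSquares (j ⊙ t)
      ≡⟨ cong (λ xs → sum (map (_^ 2) xs)) {x = indices (j ⊙ t)} {y = map (j *_) (indices t)}
           (indices-⊙ j t 1≤j 1≤b b≤q) ⟩
    sum (map (_^ 2) (map (j *_) (indices t)))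
      ≡⟨ sumOfSquares-map-* j (indices t) ⟩
    j ^ 2 * sumOfSquares t
      ≡⟨ cong (j ^ 2 *_) eq ⟩
    j ^ 2 * m ^ 2
      ≡⟨ ^-distrib-* j m 2 ⟨
    (j * m) ^ 2
      ∎)
  where open ≡-Reasoning

numTerms-⊙ : ∀ j t → 1 ≤ j → IsSolution t → numTerms (j ⊙ t) ≡ numTerms t
numTerms-⊙ j t 1≤j (1≤b , b≤q , _) =
  trans (cong length {x = indices (j ⊙ t)} {y = map (j *_) (indices t)} (indices-⊙ j t 1≤j 1≤b b≤q))
        (length-map (j *_) (indices t))

-- The multiplier is `suc k` because 0 is excluded. Distinct multipliers already differ in the first
-- coordinate, as `q` is nonzero.
Infinite-⊙ : ∀ P t → IsSolution t → (∀ j → 1 ≤ j → P (j ⊙ t)) → Infinite P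
Infinite-⊙ P t@(q , _) sol P-⊙ =
  (λ k → suc k ⊙ t) ,
  (λ {k} {l} eq → suc-injective (*-cancelʳ-≡ (suc k) (suc l) q (cong proj₁ eq))) ,
  (λ k → P-⊙ (suc k) z<s)
  where instance _ = solution⇒q≢0 t sol

-- Infinite descent modulo 3 and modulo 2.

prime∣square : ∀ {p} n → Prime p → p ∣ n * n → p ∣ n
prime∣square n p-prime p∣n² = reduce (euclidsLemma n n p-prime p∣n²)

-- Squares are 0 or 1 modulo 3, so two of them sum to 0 only if both are 0.
3∣sum-of-squares : ∀ x y → 3 ∣ x * x + y * y → 3 ∣ x × 3 ∣ y
3∣sum-of-squares x y 3∣ =
  let x≡0 , y≡0 = residues (x % 3) (y % 3) (m%n<n x 3) (m%n<n y 3)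
                    (trans (sym %-sum) (n∣m⇒m%n≡0 _ 3 3∣))
  in m%n≡0⇒n∣m x 3 x≡0 , m%n≡0⇒n∣m y 3 y≡0
  where
  %-sum : (x * x + y * y) % 3 ≡ (((x % 3) * (x % 3)) % 3 + ((y % 3) * (y % 3)) % 3) % 3
  %-sum = trans (%-distribˡ-+ (x * x) (y * y) 3)
                (cong₂ (λ u v → (u + v) % 3) (%-distribˡ-* x x 3) (%-distribˡ-* y y 3))
  residues : ∀ r s → r < 3 → s < 3 → ((r * r) % 3 + (s * s) % 3) % 3 ≡ 0 → r ≡ 0 × s ≡ 0
  residues 0 0 _ _ _ = refl , refl
  residues 0 1 _ _ ()
  residues 0 2 _ _ ()
  residues 1 0 _ _ ()
  residues 1 1 _ _ ()
  residues 1 2 _ _ ()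
  residues 2 0 _ _ ()
  residues 2 1 _ _ ()
  residues 2 2 _ _ ()
  residues (suc (suc (suc _))) _ (s≤s (s≤s (s≤s ()))) _ _
  residues _ (suc (suc (suc _))) _ (s≤s (s≤s (s≤s ()))) _

-- Adding q² to both sides makes the left a multiple of 3, so 3 divides m² + q², hence `m` and `q`.
-- With m = 3m′ and q = 3q′, dividing by 3 leaves b² + 6bq′ + 15q′² = 3m′², so 3 divides `b` too and
-- a smaller solution remains.
three-squares-descent : ∀ b q m → 3 * (b * b) + 6 * (b * q) + 5 * (q * q) ≡ m * m → q ≡ 0
three-squares-descent b q m = go b q m (<-wellFounded q)
  where
  step : ∀ b q m → 3 * (b * 3 * (b * 3)) + 6 * (b * 3 * (q * 3)) + 5 * (q * 3 * (q * 3)) ≡ m * 3 * (m * 3) →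
         3 * (b * b) + 6 * (b * q) + 5 * (q * q) ≡ m * m
  step b q m eq = *-cancelˡ-≡ _ _ 9 (trans (lhs b q) (trans eq (rhs m)))
    where
    lhs : ∀ b q → 9 * (3 * (b * b) + 6 * (b * q) + 5 * (q * q)) ≡
                  3 * (b * 3 * (b * 3)) + 6 * (b * 3 * (q * 3)) + 5 * (q * 3 * (q * 3))
    lhs = solve-∀
    rhs : ∀ m → m * 3 * (m * 3) ≡ 9 * (m * m)
    rhs = solve-∀

  3∣m²+q² : ∀ b q m → 3 * (b * b) + 6 * (b * q) + 5 * (q * q) ≡ m * m → 3 ∣ m * m + q * q
  3∣m²+q² b q m eq = divides (b * b + 2 * (b * q) + 2 * (q * q))
    (trans (cong (_+ q * q) (sym eq)) (factor b q))
    where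
    factor : ∀ b q → 3 * (b * b) + 6 * (b * q) + 5 * (q * q) + q * q ≡ (b * b + 2 * (b * q) + 2 * (q * q)) * 3
    factor = solve-∀

  3∣b² : ∀ b q m → 3 * (b * b) + 6 * (b * (q * 3)) + 5 * (q * 3 * (q * 3)) ≡ m * 3 * (m * 3) → 3 ∣ b * b
  3∣b² b q m eq = ∣m+n∣m⇒∣n {m = 3 * (2 * (b * q) + 5 * (q * q))}
    (divides (m * m) (*-cancelˡ-≡ _ _ 3 (trans (lhs b q) (trans eq (rhs m)))))
    (m∣m*n (2 * (b * q) + 5 * (q * q)))
    where
    lhs : ∀ b q → 3 * (3 * (2 * (b * q) + 5 * (q * q)) + b * b) ≡
                  3 * (b * b) + 6 * (b * (q * 3)) + 5 * (q * 3 * (q * 3))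
    lhs = solve-∀
    rhs : ∀ m → m * 3 * (m * 3) ≡ 3 * (m * m * 3)
    rhs = solve-∀

  go : ∀ b q m → Acc _<_ q → 3 * (b * b) + 6 * (b * q) + 5 * (q * q) ≡ m * m → q ≡ 0
  go b q m (acc rs) eq with 3∣sum-of-squares m q (3∣m²+q² b q m eq)
  -- The recursion needs `q′ < q′ * 3`, which fails only at 0, where the claim already holds.
  ... | divides-refl m′ , divides-refl q′ with q′ ≟ 0
  ...   | yes q′≡0 = cong (_* 3) q′≡0
  ...   | no q′≢0
    with divides-refl b′ ← prime∣square b (toWitness {a? = prime? 3} _) (3∣b² b q′ m′ eq) =
    cong (_* 3) (go b′ q′ m′ (rs (m<m*n q′ 3 {{≢-nonZero q′≢0}} (s≤s (s≤s z≤n)))) (step b′ q′ m′ eq))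

-- Parity of 3b² makes `b` even. With b = 2b′ the equation becomes q² = 2(3b′² + 2b′q), so `q` is
-- even as well, and the factor 4 cancels.
four-squares-descent : ∀ b q → 3 * (b * b) + 4 * (b * q) ≡ 2 * (q * q) → b ≡ 0
four-squares-descent b q = go b q (<-wellFounded b)
  where
  2∣b² : ∀ b q → 3 * (b * b) + 4 * (b * q) ≡ 2 * (q * q) → 2 ∣ b * b
  2∣b² b q eq = ∣m+n∣m⇒∣n {m = 2 * (b * b + 2 * (b * q))}
    (divides (q * q) (trans (lhs b q) (trans eq (*-comm 2 (q * q)))))
    (m∣m*n (b * b + 2 * (b * q)))
    where
    lhs : ∀ b q → 2 * (b * b + 2 * (b * q)) + b * b ≡ 3 * (b * b) + 4 * (b * q)
    lhs = solve-∀

  2∣q² : ∀ b q → 3 * (b * 2 * (b * 2)) + 4 * (b * 2 * q) ≡ 2 * (q * q) → 2 ∣ q * q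
  2∣q² b q eq = divides (3 * (b * b) + 2 * (b * q)) (*-cancelˡ-≡ _ _ 2 (trans (sym eq) (rhs b q)))
    where
    rhs : ∀ b q → 3 * (b * 2 * (b * 2)) + 4 * (b * 2 * q) ≡ 2 * ((3 * (b * b) + 2 * (b * q)) * 2)
    rhs = solve-∀

  step : ∀ b q → 3 * (b * 2 * (b * 2)) + 4 * (b * 2 * (q * 2)) ≡ 2 * (q * 2 * (q * 2)) →
         3 * (b * b) + 4 * (b * q) ≡ 2 * (q * q)
  step b q eq = *-cancelˡ-≡ _ _ 4 (trans (lhs b q) (trans eq (rhs q)))
    where
    lhs : ∀ b q → 4 * (3 * (b * b) + 4 * (b * q)) ≡ 3 * (b * 2 * (b * 2)) + 4 * (b * 2 * (q * 2))
    lhs = solve-∀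
    rhs : ∀ q → 2 * (q * 2 * (q * 2)) ≡ 4 * (2 * (q * q))
    rhs = solve-∀

  go : ∀ b q → Acc _<_ b → 3 * (b * b) + 4 * (b * q) ≡ 2 * (q * q) → b ≡ 0
  go b q (acc rs) eq with prime∣square b (toWitness {a? = prime? 2} _) (2∣b² b q eq)
  ... | divides-refl b′ with b′ ≟ 0
  ...   | yes b′≡0 = cong (_* 2) b′≡0
  ...   | no b′≢0
    with divides-refl q′ ← prime∣square q (toWitness {a? = prime? 2} _) (2∣q² b′ q eq) =
    cong (_* 2) (go b′ q′ (rs (m<m*n b′ 2 {{≢-nonZero b′≢0}} (s≤s (s≤s z≤n)))) (step b′ q′ eq))

-- Closed forms for short sums of squares, and comparison with the next square.

progressionSquares : ℕ → ℕ → ℕ → ℕ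
progressionSquares q b n = sum (applyUpTo (λ i → (b + i * q) * (b + i * q)) n)

sumOfSquares-progression : ∀ q b n → sum (map (_^ 2) (progression q b n)) ≡ progressionSquares q b n
sumOfSquares-progression q b n = cong sum (begin
  map (_^ 2) (progression q b n)                ≡⟨ map-cong (λ x → cong (x *_) (*-identityʳ x)) (progression q b n) ⟩
  map (λ x → x * x) (progression q b n)         ≡⟨ map-applyUpTo (λ i → b + i * q) (λ x → x * x) n ⟩
  applyUpTo (λ i → (b + i * q) * (b + i * q)) n ∎)
  where open ≡-Reasoning

progressionSquares-suc : ∀ q b n →
  progressionSquares q b (suc n) ≡ progressionSquares q b n + (b + n * q) * (b + n * q)
progressionSquares-suc q b n = begin
  sum (applyUpTo f (suc n))       ≡⟨ cong sum (applyUpTo-∷ʳ f n) ⟨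
  sum (applyUpTo f n ++ [ f n ])  ≡⟨ sum-++ (applyUpTo f n) [ f n ] ⟩
  sum (applyUpTo f n) + (f n + 0) ≡⟨ cong (λ x → sum (applyUpTo f n) + x) (+-identityʳ (f n)) ⟩
  sum (applyUpTo f n) + f n       ∎
  where
  open ≡-Reasoning
  f : ℕ → ℕ
  f i = (b + i * q) * (b + i * q)

progressionSquares-2 : ∀ q b → progressionSquares q b 2 ≡ 2 * (b * b) + 2 * (b * q) + q * q
progressionSquares-2 = expand
  where
  -- The sum to which the left-hand side reduces, including the final 0 of the empty list, is
  -- written out so that the ring solver meets a polynomial.
  expand : ∀ q b → (b + 0 * q) * (b + 0 * q) + ((b + 1 * q) * (b + 1 * q) + 0)
                   ≡ 2 * (b * b) + 2 * (b * q) + q * q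
  expand = solve-∀

progressionSquares-3 : ∀ q b → progressionSquares q b 3 ≡ 3 * (b * b) + 6 * (b * q) + 5 * (q * q)
progressionSquares-3 = expand
  where
  expand : ∀ q b → (b + 0 * q) * (b + 0 * q) + ((b + 1 * q) * (b + 1 * q) + ((b + 2 * q) * (b + 2 * q) + 0))
                   ≡ 3 * (b * b) + 6 * (b * q) + 5 * (q * q)
  expand = solve-∀

progressionSquares-4 : ∀ q b → progressionSquares q b 4 ≡ 4 * (b * b) + 12 * (b * q) + 14 * (q * q)
progressionSquares-4 = expand
  where
  expand : ∀ q b → (b + 0 * q) * (b + 0 * q) + ((b + 1 * q) * (b + 1 * q)
                     + ((b + 2 * q) * (b + 2 * q) + ((b + 3 * q) * (b + 3 * q) + 0)))
                   ≡ 4 * (b * b) + 12 * (b * q) + 14 * (q * q)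
  expand = solve-∀

-- Strict inequalities below are arranged with a surplus of b² plus a remainder, so positivity of
-- `b` suffices.
0<b²+ : ∀ b {n} .{{_ : NonZero b}} → 0 < b * b + n
0<b²+ b = ≤-trans (*-mono-≤ (>-nonZero⁻¹ b) (>-nonZero⁻¹ b)) (m≤m+n (b * b) _)

-- Induction from five terms, where the surplus is 4b² + 10bq + 5q². Each further term raises the
-- sum by at least as much as the square grows.
next-square<progressionSquares : ∀ q b k .{{_ : NonZero b}} →
  (b + (5 + k) * q) * (b + (5 + k) * q) < progressionSquares q b (5 + k)
next-square<progressionSquares q b zero = begin-strict
  (b + 5 * q) * (b + 5 * q)
    <⟨ m<n+m _ (0<b²+ b) ⟩
  (b * b + (3 * (b * b) + 10 * (b * q) + 5 * (q * q))) + (b + 5 * q) * (b + 5 * q)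
    ≡⟨ collect q b ⟩
  4 * (b * b) + 12 * (b * q) + 14 * (q * q) + (b + 4 * q) * (b + 4 * q)
    ≡⟨ cong (_+ (b + 4 * q) * (b + 4 * q)) (progressionSquares-4 q b) ⟨
  progressionSquares q b 4 + (b + 4 * q) * (b + 4 * q)
    ≡⟨ progressionSquares-suc q b 4 ⟨
  progressionSquares q b 5
    ∎
  where
  open ≤-Reasoning
  collect : ∀ q b →
    (b * b + (3 * (b * b) + 10 * (b * q) + 5 * (q * q))) + (b + 5 * q) * (b + 5 * q)
    ≡ 4 * (b * b) + 12 * (b * q) + 14 * (q * q) + (b + 4 * q) * (b + 4 * q)
  collect = solve-∀
next-square<progressionSquares q b (suc k) = begin-strict
  (b + (6 + k) * q) * (b + (6 + k) * q)
    ≤⟨ m≤n+m _ _ ⟩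
  (x * x + 4 * (x * q) + 2 * (q * q)) + (b + (6 + k) * q) * (b + (6 + k) * q)
    ≡⟨ collect q b k ⟩
  y * y + y * y
    <⟨ +-monoˡ-< (y * y) (next-square<progressionSquares q b k) ⟩
  progressionSquares q b (5 + k) + y * y
    ≡⟨ progressionSquares-suc q b (5 + k) ⟨
  progressionSquares q b (6 + k)
    ∎
  where
  open ≤-Reasoning
  x = b + (2 + k) * q
  y = b + (5 + k) * q
  -- (y + q)² ≤ 2y² because y = x + 3q.
  collect : ∀ q b k → let x = b + (2 + k) * q ; y = b + (5 + k) * q in
    (x * x + 4 * (x * q) + 2 * (q * q)) + (b + (6 + k) * q) * (b + (6 + k) * q) ≡ y * y + y * y
  collect = solve-∀

one-square : ∀ q b {m} → b + 0 * q < m → progressionSquares q b 1 ≢ m * m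
one-square q b b<m eq = <⇒≢ (*-mono-< b<m b<m) (trans (sym (+-identityʳ _)) eq)

three-squares : ∀ q b m .{{_ : NonZero q}} → progressionSquares q b 3 ≢ m * m
three-squares q b m eq =
  ≢-nonZero⁻¹ q (three-squares-descent b q m (trans (sym (progressionSquares-3 q b)) eq))

-- Writing q = b + e, the right-hand side exceeds the left by 4b² + 8be + 3e².
two-squares≢next : ∀ q b .{{_ : NonZero b}} → b ≤ q →
                   progressionSquares q b 2 ≢ (b + 2 * q) * (b + 2 * q)
two-squares≢next q b b≤q eq with e , refl ← m≤n⇒∃[o]m+o≡n b≤q =
  <⇒≢ (m<m+n _ (0<b²+ b)) (trans (sym (progressionSquares-2 q b)) (trans eq (excess b e)))
  where
  excess : ∀ b e → (b + 2 * (b + e)) * (b + 2 * (b + e))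
                   ≡ (2 * (b * b) + 2 * (b * (b + e)) + (b + e) * (b + e))
                     + (b * b + (3 * (b * b) + 8 * (b * e) + 3 * (e * e)))
  excess = solve-∀

-- Cancelling b² + 8bq + 14q² from both sides leaves 3b² + 4bq = 2q², which forces b = 0 by descent.
four-squares≢next : ∀ q b .{{_ : NonZero b}} → progressionSquares q b 4 ≢ (b + 4 * q) * (b + 4 * q)
four-squares≢next q b eq = ≢-nonZero⁻¹ b (four-squares-descent b q
  (+-cancelˡ-≡ (b * b + 8 * (b * q) + 14 * (q * q)) _ _
    (trans (lhs b q) (trans (trans (sym (progressionSquares-4 q b)) eq) (rhs b q)))))
  where
  lhs : ∀ b q → (b * b + 8 * (b * q) + 14 * (q * q)) + (3 * (b * b) + 4 * (b * q))
                ≡ 4 * (b * b) + 12 * (b * q) + 14 * (q * q)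
  lhs = solve-∀
  rhs : ∀ b q → (b + 4 * q) * (b + 4 * q) ≡ (b * b + 8 * (b * q) + 14 * (q * q)) + 2 * (q * q)
  rhs = solve-∀

-- The number of terms of a solution.

-- As an indexed family, matching on it replaces `n` by a numeral, so that lengths and bounds
-- compute.
data TwoOrFour : ℕ → Set where
  two  : TwoOrFour 2
  four : TwoOrFour 4

firstPast-twoOrFour : ∀ q b m n → 1 ≤ b → b ≤ q → 2 ≤ m → FirstPast (q , b , m) n →
                      progressionSquares q b n ≡ m * m → TwoOrFour n
firstPast-twoOrFour q b m 0 _ _ 2≤m _ eq = contradiction eq (<⇒≢ (*-mono-≤ (<⇒≤ 2≤m) (<⇒≤ 2≤m)))
firstPast-twoOrFour q b m 1 _ _ _ (below , _) eq = contradiction eq (one-square q b (below 0 z<s))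
firstPast-twoOrFour q b m 2 _ _ _ _ _ = two
firstPast-twoOrFour q b m 3 1≤b b≤q _ _ eq =
  contradiction eq (three-squares q b m {{>-nonZero (≤-trans 1≤b b≤q)}})
firstPast-twoOrFour q b m 4 _ _ _ _ _ = four
-- Here m² ≤ (b + nq)² by `above`, while the sum, equal to m², is strictly larger than (b + nq)².
firstPast-twoOrFour q b m (suc (suc (suc (suc (suc k))))) 1≤b _ _ (_ , above) eq =
  contradiction (*-mono-≤ above above)
    (<⇒≱ (subst ((b + (5 + k) * q) * (b + (5 + k) * q) <_) eq
      (next-square<progressionSquares q b k {{>-nonZero 1≤b}})))

solution-progression : ∀ q b m → IsSolution (q , b , m) →
  ∃[ n ] TwoOrFour n × FirstPast (q , b , m) n × indices (q , b , m) ≡ progression q b n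
         × progressionSquares q b n ≡ m * m
solution-progression q b m (1≤b , b≤q , 2≤m , eq)
  with n , past , indices≡ ← indices-progression q b 1≤b b≤q m =
  n , firstPast-twoOrFour q b m n 1≤b b≤q 2≤m past eq′ , past , indices≡ , eq′
  where
  eq′ : progressionSquares q b n ≡ m * m
  eq′ = begin
    progressionSquares q b n              ≡⟨ sumOfSquares-progression q b n ⟨
    sum (map (_^ 2) (progression q b n))  ≡⟨ cong (λ xs → sum (map (_^ 2) xs)) indices≡ ⟨
    sumOfSquares (q , b , m)              ≡⟨ eq ⟩
    m ^ 2                                 ≡⟨ cong (m *_) (*-identityʳ m) ⟩
    m * m                                 ∎
    where open ≡-Reasoning

numTerms-twoOrFour : ∀ t → IsSolution t → numTerms t ≡ 2 ⊎ numTerms t ≡ 4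
numTerms-twoOrFour (q , b , m) sol with solution-progression q b m sol
... | _ , two  , _ , indices≡ , _ = inj₁ (cong length indices≡)
... | _ , four , _ , indices≡ , _ = inj₂ (cong length indices≡)

-- Goodness.

floor-+ : ∀ x q .{{_ : NonZero q}} → floor (+ x ℚᵘ./ q) ≡ + (x / q)
-- With `q` a visible successor, the floor reduces to the natural quotient times the unit sign of
-- the divisor.
floor-+ x (suc _) = ℤ.*-identityˡ _

+m+n-+m : ∀ m n → + (m + n) ℤ.- + m ≡ + n
+m+n-+m m n = trans (ℤ.m-n≡m⊖n (m + n) m) (trans (ℤ.⊖-≥ (m≤m+n m n)) (cong +_ (m+n∸m≡n m n)))

[k*q+r]/q≡k : ∀ k r q .{{_ : NonZero q}} → r < q → (k * q + r) / q ≡ k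
[k*q+r]/q≡k k r q r<q = begin
  (k * q + r) / q     ≡⟨ +-distrib-/-∣ˡ r (n∣m*n k) ⟩
  k * q / q + r / q   ≡⟨ cong₂ _+_ (m*n/n≡m k q) (m<n⇒m/n≡0 r<q) ⟩
  k + 0               ≡⟨ +-identityʳ k ⟩
  k                   ∎
  where open ≡-Reasoning

-- The lower bound reads `suc (b + k * q) ≤ m`, so its slack `r` is the remainder of m - b - 1 and
-- `suc r` that of m - b. The upper bound gives `suc r < q`, hence both quotients are `k`.
between⇒Good : ∀ q b m k .{{_ : NonZero q}} → b + k * q < m → m < b + suc k * q → Good (q , b , m)
between⇒Good q b m k b+kq<m m<b+q+kq with r , refl ← m≤n⇒∃[o]m+o≡n b+kq<m = begin
  floor ((+ m ℤ.- + b) ℚᵘ./ q)           ≡⟨ cong (λ x → floor (x ℚᵘ./ q)) m-b ⟩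
  floor (+ (k * q + suc r) ℚᵘ./ q)       ≡⟨ floor-+ (k * q + suc r) q ⟩
  + ((k * q + suc r) / q)                ≡⟨ cong +_ ([k*q+r]/q≡k k (suc r) q 1+r<q) ⟩
  + k                                    ≡⟨ cong +_ ([k*q+r]/q≡k k r q (<-trans ≤-refl 1+r<q)) ⟨
  + ((k * q + r) / q)                    ≡⟨ floor-+ (k * q + r) q ⟨
  floor (+ (k * q + r) ℚᵘ./ q)           ≡⟨ cong (λ x → floor (x ℚᵘ./ q)) m-b-1 ⟨
  floor ((+ m ℤ.- + b ℤ.- 1ℤ) ℚᵘ./ q)    ∎
  where
  open ≡-Reasoning
  m≡ : m ≡ b + (k * q + suc r)
  m≡ = trans (sym (+-suc (b + k * q) r)) (+-assoc b (k * q) (suc r))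
  1+r<q : suc r < q
  1+r<q = +-cancelʳ-< (k * q) _ _ (subst (_< q + k * q) (+-comm (k * q) (suc r))
    (+-cancelˡ-< b _ _ (subst (_< b + suc k * q) m≡ m<b+q+kq)))
  m-b : + m ℤ.- + b ≡ + (k * q + suc r)
  m-b = trans (cong (λ x → + x ℤ.- + b) m≡) (+m+n-+m b _)
  m-b-1 : + m ℤ.- + b ℤ.- 1ℤ ≡ + (k * q + r)
  m-b-1 = trans (cong (ℤ._- 1ℤ) (trans m-b (cong +_ (+-suc (k * q) r)))) (+m+n-+m 1 (k * q + r))

-- With n terms the quotient is n - 1, hence the 1 and 3 below. The bound m ≤ b + nq is strict
-- because equality would make the sum the next square.
solution⇒Good : ∀ t (s : IsSolution t) → Good t {{solution⇒q≢0 t s}}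
solution⇒Good t@(q , b , m) s@(1≤b , b≤q , _) with solution-progression q b m s
... | _ , two , (below , above) , _ , eq =
  between⇒Good q b m 1 {{solution⇒q≢0 t s}} (below 1 ≤-refl)
    (≤∧≢⇒< above λ { refl → two-squares≢next q b {{>-nonZero 1≤b}} b≤q eq })
... | _ , four , (below , above) , _ , eq =
  between⇒Good q b m 3 {{solution⇒q≢0 t s}} (below 3 ≤-refl)
    (≤∧≢⇒< above λ { refl → four-squares≢next q b {{>-nonZero 1≤b}} eq })

-- Lines of solutions and assembly of the four claims.

PositiveMultiples-evenlySpaced : ∀ t → t ≢ (0 , 0 , 0) → EvenlySpacedOnLine (PositiveMultiples t)
-- Starting point and direction are both `t`, so step `k` along the line is the multiple
-- `suc k ⊙ t`.
PositiveMultiples-evenlySpaced t t≢0 = t , t , t≢0 , λ s → mk⇔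
  (λ { (suc k , _ , s≡) → k , s≡ })
  (λ { (k , s≡) → suc k , z<s , s≡ })

1⊙ : ∀ t → t ≡ 1 ⊙ t
1⊙ (q , b , m) = sym (cong₂ _,_ (*-identityˡ q) (cong₂ _,_ (*-identityˡ b) (*-identityˡ m)))

theorem1p4 : (∀ t → IsSolution t → numTerms t ≡ 2 ⊎ numTerms t ≡ 4)
    × (Infinite (λ t → IsSolution t × numTerms t ≡ 2)
    × Infinite (λ t → IsSolution t × numTerms t ≡ 4))
    × (∀ t → (s : IsSolution t) → Good t {{solution⇒q≢0 t s}})
    × (∀ q b m → IsSolution (q , b , m) →
    (q , b , m) ∈ PositiveMultiples (q , b , m)
    × Infinite (PositiveMultiples (q , b , m))
    × EvenlySpacedOnLine (PositiveMultiples (q , b , m))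
    × PositiveMultiples (q , b , m) ⊆ IsSolution
    × (∀ (j : ℕ) → 1 ≤ j → IsSolution (j * q , j * b , j * m)))
theorem1p4 =
  numTerms-twoOrFour ,
  (multiples-infinite (7 , 5 , 13) solution₂ refl , multiples-infinite (24 , 5 , 98) solution₄ refl) ,
  solution⇒Good ,
  λ q b m sol → let t = (q , b , m) in
    (1 , ≤-refl , 1⊙ t) ,
    Infinite-⊙ (PositiveMultiples t) t sol (λ j 1≤j → j , 1≤j , refl) ,
    PositiveMultiples-evenlySpaced t
      -- The direction is nonzero because its second coordinate `b` is positive.
      (λ t≡0 → m<n⇒n≢0 (proj₁ sol) (cong (λ s → proj₁ (proj₂ s)) t≡0)) ,
    (λ { (j , 1≤j , refl) → IsSolution-⊙ j t 1≤j sol }) ,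
    (λ j 1≤j → IsSolution-⊙ j t 1≤j sol)
  where
  -- 5² + 12² = 13²
  solution₂ : IsSolution (7 , 5 , 13)
  solution₂ = toWitness {a? = 1 ≤? 5} _ , toWitness {a? = 5 ≤? 7} _ , toWitness {a? = 2 ≤? 13} _ , refl
  -- 5² + 29² + 53² + 77² = 98²
  solution₄ : IsSolution (24 , 5 , 98)
  solution₄ = toWitness {a? = 1 ≤? 5} _ , toWitness {a? = 5 ≤? 24} _ , toWitness {a? = 2 ≤? 98} _ , refl

  multiples-infinite : ∀ t {n} → IsSolution t → numTerms t ≡ n →
                       Infinite (λ s → IsSolution s × numTerms s ≡ n)
  multiples-infinite t {n} sol numTerms≡n =
    Infinite-⊙ (λ s → IsSolution s × numTerms s ≡ n) t sol
      (λ j 1≤j → IsSolution-⊙ j t 1≤j sol , trans (numTerms-⊙ j t 1≤j sol) numTerms≡n)
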